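{- Let $L$ be either of the sequent calculi $\mathrm{sMC}^*$, $\mathrm{sCN}^*$. For every formula $\alpha$ and every finite set $\Gamma$ of formulas, the sequent $\alpha,\Gamma\Rightarrow\alpha$ is provable in $L$.
   Context: Formulas are built from countably many propositional variables $p,q,\dots$ using the binary connectives $\land,\lor,\to$ and the unary connective $\sim$. A sequent is an expression $\Gamma\Rightarrow\gamma$ with $\Gamma$ a finite (possibly empty) set of formulas and $\gamma$ a single formula; $\alpha,\Gamma$ means $\{\alpha\}\cup\Gamma$ and $\Gamma,\Delta$ means $\Gamma\cup\Delta$. The calculus $\mathrm{sC}$ has the following initial sequents and rules ($p$ any propositional variable; $\alpha,\beta,\gamma$ any formulas; $\Gamma,\Delta,\Sigma$ any finite sets of formulas). Initial sequents: (init1) $p,\Gamma\Rightarrow p$; (init2) $\sim p,\Gamma\Rightarrow\sim p$. (cut): from $\Gamma\Rightarrow\alpha$ and $\alpha,\Sigma\Rightarrow\gamma$ infer $\Gamma,\Sigma\Rightarrow\gamma$. ($\to$left): from $\Gamma\Rightarrow\alpha$ and $\beta,\Delta\Rightarrow\gamma$ infer $\alpha\to\beta,\Gamma,\Delta\Rightarrow\gamma$. ($\to$right): from $\alpha,\Gamma\Rightarrow\beta$ infer $\Gamma\Rightarrow\alpha\to\beta$. ($\land$left): from $\alpha,\beta,\Gamma\Rightarrow\gamma$ infer $\alpha\land\beta,\Gamma\Rightarrow\gamma$. ($\land$right): from $\Gamma\Rightarrow\alpha$ and $\Gamma\Rightarrow\beta$ infer $\Gamma\Rightarrow\alpha\land\beta$.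 ($\lor$left): from $\alpha,\Gamma\Rightarrow\gamma$ and $\beta,\Gamma\Rightarrow\gamma$ infer $\alpha\lor\beta,\Gamma\Rightarrow\gamma$. ($\lor$right1), ($\lor$right2): from $\Gamma\Rightarrow\alpha$ (respectively $\Gamma\Rightarrow\beta$) infer $\Gamma\Rightarrow\alpha\lor\beta$. ($\sim$left): from $\alpha,\Gamma\Rightarrow\gamma$ infer $\sim\sim\alpha,\Gamma\Rightarrow\gamma$. ($\sim$right): from $\Gamma\Rightarrow\alpha$ infer $\Gamma\Rightarrow\sim\sim\alpha$. ($\sim\to$left): from $\Gamma\Rightarrow\alpha$ and $\sim\beta,\Delta\Rightarrow\gamma$ infer $\sim(\alpha\to\beta),\Gamma,\Delta\Rightarrow\gamma$. ($\sim\to$right): from $\alpha,\Gamma\Rightarrow\sim\beta$ infer $\Gamma\Rightarrow\sim(\alpha\to\beta)$. ($\sim\land$left): from $\sim\alpha,\Gamma\Rightarrow\gamma$ and $\sim\beta,\Gamma\Rightarrow\gamma$ infer $\sim(\alpha\land\beta),\Gamma\Rightarrow\gamma$. ($\sim\land$right1), ($\sim\land$right2): from $\Gamma\Rightarrow\sim\alpha$ (respectively $\Gamma\Rightarrow\sim\beta$) infer $\Gamma\Rightarrow\sim(\alpha\land\beta)$. ($\sim\lor$left): from $\sim\alpha,\sim\beta,\Gamma\Rightarrow\gamma$ infer $\sim(\alpha\lor\beta),\Gamma\Rightarrow\gamma$. ($\sim\lor$right): from $\Gamma\Rightarrow\sim\alpha$ and $\Gamma\Rightarrow\sim\beta$ infer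 $\Gamma\Rightarrow\sim(\alpha\lor\beta)$. Additional rules: (ex-middle): from $\sim\alpha,\Gamma\Rightarrow\gamma$ and $\alpha,\Gamma\Rightarrow\gamma$ infer $\Gamma\Rightarrow\gamma$. (g-ex-middle): from $\alpha\to\beta,\Gamma\Rightarrow\gamma$ and $\alpha,\Gamma\Rightarrow\gamma$ infer $\Gamma\Rightarrow\gamma$. $\mathrm{sMC}^*=\mathrm{sC}+$(g-ex-middle); $\mathrm{sCN}^*=\mathrm{sC}+$(ex-middle)$+$(g-ex-middle). -}

module Defs where

open import Data.List.Base using (List; []; _∷_; _++_)
open import Data.List.Membership.Propositional using (_∈_)
open import Data.List.Relation.Binary.BagAndSetEquality using (_∼[_]_; set)
open import Data.Nat.Base using (ℕ)

infix  9 ∼_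
infixr 8 _∧_
infixr 7 _∨_
infixr 6 _⟶_
infix  4 _⇒_
infix  3 _⊢_

data Formula : Set where
  var : ℕ → Formula
  _∧_ _∨_ _⟶_ : Formula → Formula → Formula
  ∼_ : Formula → Formula

-- A finite set of formulas is represented by a list enumerating its elements,
-- in any order and with any repetitions.  Thus α , Γ is α ∷ Γ and Γ , Δ is Γ ++ Δ.
-- Lists with the same elements are identified by the constructor `resp` of _⊢_.
data Sequent : Set where
  _⇒_ : List Formula → Formula → Sequent

data ExtraRule : Set where
  ex-middle g-ex-middle : ExtraRule

-- A calculus is given by the rules it adds to sC.
Calculus : Set
Calculus = List ExtraRule

sC sMC* sCN* : Calculus
sC   = []
sMC* = g-ex-middle ∷ []
sCN* = ex-middle ∷ g-ex-middle ∷ []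

private variable
  p : ℕ
  α β γ : Formula
  Γ Δ Σ : List Formula

data _⊢_ (L : Calculus) : Sequent → Set where
  -- Not an inference rule of the calculus: it only changes the list that
  -- represents the antecedent set.  In particular it gives no weakening.
  resp    : Γ ∼[ set ] Δ → L ⊢ Γ ⇒ γ → L ⊢ Δ ⇒ γ

  init1   : L ⊢ var p ∷ Γ ⇒ var p
  init2   : L ⊢ ∼ var p ∷ Γ ⇒ ∼ var p
  cut     : L ⊢ Γ ⇒ α → L ⊢ α ∷ Σ ⇒ γ → L ⊢ Γ ++ Σ ⇒ γ

  ⟶left   : L ⊢ Γ ⇒ α → L ⊢ β ∷ Δ ⇒ γ → L ⊢ α ⟶ β ∷ Γ ++ Δ ⇒ γ
  ⟶right  : L ⊢ α ∷ Γ ⇒ β → L ⊢ Γ ⇒ α ⟶ β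
  ∧left   : L ⊢ α ∷ β ∷ Γ ⇒ γ → L ⊢ α ∧ β ∷ Γ ⇒ γ
  ∧right  : L ⊢ Γ ⇒ α → L ⊢ Γ ⇒ β → L ⊢ Γ ⇒ α ∧ β
  ∨left   : L ⊢ α ∷ Γ ⇒ γ → L ⊢ β ∷ Γ ⇒ γ → L ⊢ α ∨ β ∷ Γ ⇒ γ
  ∨right1 : L ⊢ Γ ⇒ α → L ⊢ Γ ⇒ α ∨ β
  ∨right2 : L ⊢ Γ ⇒ β → L ⊢ Γ ⇒ α ∨ β

  ∼left    : L ⊢ α ∷ Γ ⇒ γ → L ⊢ ∼ ∼ α ∷ Γ ⇒ γ
  ∼right   : L ⊢ Γ ⇒ α → L ⊢ Γ ⇒ ∼ ∼ α
  ∼⟶left   : L ⊢ Γ ⇒ α → L ⊢ ∼ β ∷ Δ ⇒ γ → L ⊢ ∼ (α ⟶ β) ∷ Γ ++ Δ ⇒ γ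
  ∼⟶right  : L ⊢ α ∷ Γ ⇒ ∼ β → L ⊢ Γ ⇒ ∼ (α ⟶ β)
  ∼∧left   : L ⊢ ∼ α ∷ Γ ⇒ γ → L ⊢ ∼ β ∷ Γ ⇒ γ → L ⊢ ∼ (α ∧ β) ∷ Γ ⇒ γ
  ∼∧right1 : L ⊢ Γ ⇒ ∼ α → L ⊢ Γ ⇒ ∼ (α ∧ β)
  ∼∧right2 : L ⊢ Γ ⇒ ∼ β → L ⊢ Γ ⇒ ∼ (α ∧ β)
  ∼∨left   : L ⊢ ∼ α ∷ ∼ β ∷ Γ ⇒ γ → L ⊢ ∼ (α ∨ β) ∷ Γ ⇒ γ
  ∼∨right  : L ⊢ Γ ⇒ ∼ α → L ⊢ Γ ⇒ ∼ β → L ⊢ Γ ⇒ ∼ (α ∨ β)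

  ex-mid   : ex-middle ∈ L →
             L ⊢ ∼ α ∷ Γ ⇒ γ → L ⊢ α ∷ Γ ⇒ γ → L ⊢ Γ ⇒ γ
  g-ex-mid : g-ex-middle ∈ L →
             L ⊢ α ⟶ β ∷ Γ ⇒ γ → L ⊢ α ∷ Γ ⇒ γ → L ⊢ Γ ⇒ γ

{-# OPTIONS --safe #-}
module Submission where

open import Data.List.Base using (List; _∷_; _++_)
open import Data.List.Relation.Binary.BagAndSetEquality
  using (_∼[_]_; set; ∷-cong; ++-idempotent; ↭⇒∼bag; bag-=⇒; [_]-Equality)
open import Data.List.Relation.Binary.Permutation.Propositional using (↭-refl; ↭-swap)
open import Data.Sum.Base using (_⊎_)
open import Relation.Binary.Bundles using (Setoid)
open import Relation.Binary.PropositionalEquality using (_≡_; refl)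
open import Defs

∷-swap : ∀ {a} {A : Set a} (x y : A) (zs : List A) → x ∷ y ∷ zs ∼[ set ] y ∷ x ∷ zs
∷-swap x y zs = bag-=⇒ (↭⇒∼bag (↭-swap x y ↭-refl))

∷-swap-++-idem : ∀ {a} {A : Set a} (x y : A) (zs : List A) →
                 x ∷ y ∷ zs ++ zs ∼[ set ] y ∷ x ∷ zs
∷-swap-++-idem {A = A} x y zs =
  Setoid.trans ([ set ]-Equality A) (∷-swap x y (zs ++ zs))
    (∷-cong refl (∷-cong refl (++-idempotent zs)))

identity  : ∀ {L} α Γ → L ⊢ α ∷ Γ ⇒ α
identity∼ : ∀ {L} α Γ → L ⊢ ∼ α ∷ Γ ⇒ ∼ α

identity (var p) Γ = init1
identity (α ∧ β) Γ =
  ∧left (∧right (identity α (β ∷ Γ)) (resp (∷-swap β α Γ) (identity β (α ∷ Γ))))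
identity (α ∨ β) Γ = ∨left (∨right1 (identity α Γ)) (∨right2 (identity β Γ))
identity (α ⟶ β) Γ =
  ⟶right (resp (∷-swap-++-idem (α ⟶ β) α Γ) (⟶left (identity α Γ) (identity β Γ)))
identity (∼ α) Γ = identity∼ α Γ

identity∼ (var p) Γ = init2
identity∼ (α ∧ β) Γ = ∼∧left (∼∧right1 (identity∼ α Γ)) (∼∧right2 (identity∼ β Γ))
identity∼ (α ∨ β) Γ =
  ∼∨left (∼∨right (identity∼ α (∼ β ∷ Γ))
                  (resp (∷-swap (∼ β) (∼ α) Γ) (identity∼ β (∼ α ∷ Γ))))
identity∼ (α ⟶ β) Γ =
  ∼⟶right (resp (∷-swap-++-idem (∼ (α ⟶ β)) α Γ)
                (∼⟶left (identity α Γ) (identity∼ β Γ)))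
identity∼ (∼ α) Γ = ∼left (∼right (identity α Γ))

proposition2p10 : (L : Calculus) → L ≡ sMC* ⊎ L ≡ sCN* →
    (α : Formula) (Γ : List Formula) → L ⊢ α ∷ Γ ⇒ α
proposition2p10 L _ = identity
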